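{- For all $r,t\in\mathbb{N}$, every graph $G$ that does not contain the complete graph $K_t$ as a minor satisfies $\operatorname{cw}_r(G)\leq \binom{t-1}{2}(8r+1)$.
   Context: All graphs are finite, simple and undirected; $\mathbb{N}=\{1,2,\dots\}$. Cop-width game with radius $r$ and width $k$ on $G$: initially the cops occupy a set $C_0\subseteq V(G)$ with $|C_0|\le k$ and the robber chooses a vertex $x_0$. In each round $i\ge1$, the cops announce a new set $C_i\subseteq V(G)$ with $|C_i|\le k$; the robber, knowing $C_i$, moves from $x_{i-1}$ to a vertex $x_i$ along a path in $G$ of length at most $r$ containing no vertex of $C_{i-1}\cap C_i$. The robber is caught if $x_i\in C_i$. The radius-$r$ cop-width $\operatorname{cw}_r(G)$ is the least $k\in\mathbb{N}$ such that the cops can guarantee capture in finitely many rounds.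
   Formalization: The theorem is stated for t ≥ 3: for t ≤ 2 the bound is 0, while the cop-width is at least 1 by definition (for example, the one-vertex graph has no K_2 minor and has cop-width 1), so the claim fails there. -}

module Defs where

open import Data.Nat using (ℕ; zero; suc; _≤_)
open import Data.Fin using (Fin)
open import Data.Fin.Subset using (Subset; _∈_; _∉_; _∩_; ∣_∣)
open import Data.Maybe using (Maybe; just)
open import Data.Product using (Σ; ∃; ∃₂; _×_)
open import Data.Sum using (_⊎_)
open import Relation.Binary.PropositionalEquality using (_≡_; _≢_)
open import Relation.Nullary using (¬_)

record Graph : Set₁ where
  field
    n     : ℕ
    Adj   : Fin n → Fin n → Set
    sym   : ∀ {u v} → Adj u v → Adj v u
    irref : ∀ {u} → ¬ Adj u u

module _ (G : Graph) where
  open Graph G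

  data WalkIn (P : Fin n → Set) : Fin n → Fin n → Set where
    here : ∀ {x} → P x → WalkIn P x x
    step : ∀ {x y z} → P x → Adj x y → WalkIn P y z → WalkIn P x z

  -- K_t minor model: disjoint (built in) nonempty connected branch sets,
  -- pairwise joined by an edge.
  record CliqueMinor (t : ℕ) : Set where
    field
      branch    : Fin n → Maybe (Fin t)
      nonempty  : ∀ i → ∃ λ v → branch v ≡ just i
      connected : ∀ i u v → branch u ≡ just i → branch v ≡ just i →
                  WalkIn (λ w → branch w ≡ just i) u v
      adjacent  : ∀ i j → i ≢ j → ∃₂ λ u v →
                  branch u ≡ just i × branch v ≡ just j × Adj u v

  HasCliqueMinor : ℕ → Set
  HasCliqueMinor t = CliqueMinor t

  data Reach (S : Subset n) : ℕ → Fin n → Fin n → Set where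
    here : ∀ {m x} → x ∉ S → Reach S m x x
    step : ∀ {m x y z} → x ∉ S → Adj x y → Reach S m y z → Reach S (suc m) x z

  -- CopsWinFrom r k C x : in the position where the cops currently occupy C
  -- and the robber (not caught) is at x, the cops can force capture in
  -- finitely many rounds (inductive = well-founded attractor).
  data CopsWinFrom (r k : ℕ) : Subset n → Fin n → Set where
    win : ∀ {C x} (C′ : Subset n) → ∣ C′ ∣ ≤ k →
          (∀ x′ → Reach (C ∩ C′) r x x′ → x′ ∈ C′ ⊎ CopsWinFrom r k C′ x′) →
          CopsWinFrom r k C x

  CopsWin : ℕ → ℕ → Set
  CopsWin r k = Σ (Subset n) λ C₀ → ∣ C₀ ∣ ≤ k ×
                (∀ x₀ → x₀ ∈ C₀ ⊎ CopsWinFrom r k C₀ x₀)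

  -- cw_r(G) ≤ B, where cw_r(G) is the least k ∈ {1,2,…} with CopsWin r k
  CopWidthAtMost : ℕ → ℕ → Set
  CopWidthAtMost r B = ∃ λ k → 1 ≤ k × k ≤ B × CopsWin r k

{-# OPTIONS --safe #-}
module Submission where

open import Defs
open import Data.Fin using (Fin; zero; suc; combine; remQuot; inject≤; _≟_)
open import Data.Fin.Properties using (any?; remQuot-combine; inject≤-injective)
open import Data.Fin.Subset using (Subset; _∈_; _∉_; _⊆_; _⊂_; _⊃_; _∩_; _∪_; _─_; ∁; ⋃; ⁅_⁆; ∣_∣; ⊤; inside; outside; Lift) renaming (⊥ to ∅)
open import Data.Fin.Subset.Induction using (⊂-wellFounded; ⊃-wellFounded)
open import Data.Fin.Subset.Properties using (_∈?_; ∉⊥; ∈⊤; ∣⊥∣≡0; ∣⁅x⁆∣≡1; ∣p∣≤∣x∷p∣; x∈⁅x⁆; x∈⁅y⁆⇒x≡y; x∈p∪q⁻; x∈p∩q⁺; p⊆p∪q; q⊆p∪q; p─q⊆p; x∈p∧x∉q⇒x∈p─q; p∩q≢∅⇒p─q⊂p; ⊆-⊂-trans; x∈∁p⇒x∉p; x∉p⇒x∈∁p)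
open import Data.List using (List; []; _∷_; length; lookup; filter)
open import Data.List.Membership.Propositional using (find; lose)
open import Data.List.Membership.Propositional.Properties using (∈-filter⁺; ∈-lookup)
open import Data.List.Relation.Unary.All as All using (All; []; _∷_)
open import Data.List.Relation.Unary.All.Properties using (all-filter) renaming (filter⁺ to All-filter⁺)
open import Data.List.Relation.Unary.AllPairs using (AllPairs; []; _∷_)
open import Data.List.Relation.Unary.AllPairs.Properties using () renaming (filter⁺ to AllPairs-filter⁺)
open import Data.List.Relation.Unary.Any using (Any; here; there)
open import Data.Maybe using (Maybe; just; nothing)
open import Data.Nat using (ℕ; zero; suc; pred; NonZero; _≤_; _<_; _*_; _+_; _∸_; z≤n; s≤s)
open import Data.Nat.Combinatorics using (_C_; nC1≡n; nCk+nC[k+1]≡[n+1]C[k+1])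
open import Data.Nat.Properties using (≤-trans; ≤-reflexive; ≤-pred; <⇒≤; <⇒≤pred; ≰⇒>; m≤m+n; m≤n+m; +-suc; +-mono-≤; +-monoʳ-≤; +-cancelʳ-≤; *-monoˡ-≤; *-cancelˡ-≤; *-assoc; *-distribˡ-+; module ≤-Reasoning)
open import Data.Nat.Tactic.RingSolver using (solve-∀)
open import Data.Product using (∃; ∃₂; _×_; _,_; proj₁; proj₂; uncurry)
open import Data.Sum using (_⊎_; inj₁; inj₂; [_,_]′; map₁; map₂; swap)
open import Data.Vec using ([]; _∷_; here; there)
open import Function using (_∘_)
open import Induction.WellFounded using (Acc; acc)
open import Level using (Level)
open import Relation.Binary.Definitions using (Decidable; Symmetric)
open import Relation.Binary.PropositionalEquality using (_≡_; _≢_; refl; sym; cong; subst; module ≡-Reasoning)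
open import Relation.Nullary using (¬_; Dec; yes; no; contradiction)
open import Relation.Nullary.Decidable using (_×-dec_; _⊎-dec_; map′)
open import Relation.Unary using (Pred)

-- The robber is kept in a connected territory X whose boundary lies in "bags":
-- connected, pairwise disjoint and adjacent sets, all adjacent to X. Together
-- with X they form a clique minor, so there are at most t - 2 of them. In each
-- round the cops add a bag N, the union of geodesics of X from the robber's
-- vertex to the existing bags, and pass to the component of X - N containing
-- the robber; bags no longer adjacent to it are discarded. Only bag vertices
-- within distance 2r - 1 of the robber need cops, and a geodesic has at most
-- 4r - 1 of these, so (t - 1)((t - 2)(4r - 1) + 1) cops suffice.
--
-- Adjacency is not assumed decidable. The cops therefore play on the subgraph of
-- edges seen so far; a robber move outside it reveals a new edge, after which
-- they start again, and this happens only finitely often.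

module _ {n : ℕ} {ℓ : Level} where

  ∅-elim : ∀ {C : Set ℓ} {x : Fin n} → x ∈ ∅ → C
  ∅-elim x∈∅ = contradiction x∈∅ ∉⊥

  ⁅⁆-elim : ∀ (P : Pred (Fin n) ℓ) {x} → P x → Lift P ⁅ x ⁆
  ⁅⁆-elim P {x} px y∈⁅x⁆ = subst P (sym (x∈⁅y⁆⇒x≡y x y∈⁅x⁆)) px

  ∪-elim : ∀ {C : Set ℓ} {x} (p q : Subset n) → (x ∈ p → C) → (x ∈ q → C) → x ∈ p ∪ q → C
  ∪-elim p q f g = [ f , g ]′ ∘ x∈p∪q⁻ p q

x∈p─q⇒x∉q : ∀ {n x} (p q : Subset n) → x ∈ p ─ q → x ∉ q
x∈p─q⇒x∉q (_ ∷ p) (inside ∷ q) (there x∈p─q) (there x∈q) = x∈p─q⇒x∉q p q x∈p─q x∈q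
x∈p─q⇒x∉q (_ ∷ p) (outside ∷ q) (there x∈p─q) (there x∈q) = x∈p─q⇒x∉q p q x∈p─q x∈q

p⊂p∪⁅x⁆ : ∀ {n} {p : Subset n} {x} → x ∉ p → p ⊂ p ∪ ⁅ x ⁆
p⊂p∪⁅x⁆ {p = p} {x} x∉p = p⊆p∪q ⁅ x ⁆ , x , q⊆p∪q p ⁅ x ⁆ (x∈⁅x⁆ x) , x∉p

∣∅∣≤ : ∀ n {k} → ∣ ∅ {n} ∣ ≤ k
∣∅∣≤ n = ≤-trans (≤-reflexive (∣⊥∣≡0 n)) z≤n

∣p∪q∣≤∣p∣+∣q∣ : ∀ {n} (p q : Subset n) → ∣ p ∪ q ∣ ≤ ∣ p ∣ + ∣ q ∣
∣p∪q∣≤∣p∣+∣q∣ [] [] = z≤n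
∣p∪q∣≤∣p∣+∣q∣ (inside ∷ p) (x ∷ q) =
  s≤s (≤-trans (∣p∪q∣≤∣p∣+∣q∣ p q) (+-monoʳ-≤ ∣ p ∣ (∣p∣≤∣x∷p∣ x q)))
∣p∪q∣≤∣p∣+∣q∣ (outside ∷ p) (inside ∷ q) =
  ≤-trans (s≤s (∣p∪q∣≤∣p∣+∣q∣ p q)) (≤-reflexive (sym (+-suc ∣ p ∣ ∣ q ∣)))
∣p∪q∣≤∣p∣+∣q∣ (outside ∷ p) (outside ∷ q) = ∣p∪q∣≤∣p∣+∣q∣ p q

∈⋃⁺ : ∀ {n x} {ps : List (Subset n)} → Any (x ∈_) ps → x ∈ ⋃ ps
∈⋃⁺ {ps = p ∷ ps} (here x∈p) = p⊆p∪q (⋃ ps) x∈p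
∈⋃⁺ {ps = p ∷ ps} (there x∈ps) = q⊆p∪q p (⋃ ps) (∈⋃⁺ x∈ps)

∈⋃⁻ : ∀ {n x} (ps : List (Subset n)) → x ∈ ⋃ ps → Any (x ∈_) ps
∈⋃⁻ [] = ∅-elim
∈⋃⁻ (p ∷ ps) = ∪-elim p (⋃ ps) here (there ∘ ∈⋃⁻ ps)

AllPairs-lookup : ∀ {a ℓ} {A : Set a} {R : A → A → Set ℓ} → Symmetric R →
                  ∀ {xs} → AllPairs R xs → ∀ {i j} → i ≢ j → R (lookup xs i) (lookup xs j)
AllPairs-lookup R-sym (rx ∷ rxs) {zero} {zero} i≢j = contradiction refl i≢j
AllPairs-lookup R-sym (rx ∷ rxs) {zero} {suc j} i≢j = All.lookup rx (∈-lookup j)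
AllPairs-lookup R-sym (rx ∷ rxs) {suc i} {zero} i≢j = R-sym (All.lookup rx (∈-lookup i))
AllPairs-lookup R-sym (rx ∷ rxs) {suc i} {suc j} i≢j = AllPairs-lookup R-sym rxs (i≢j ∘ cong suc)

module Walks (G : Graph) where
  open Graph G renaming (sym to Adj-sym)

  private variable
    k k′ m m′ : ℕ
    p x y z : Fin n
    X Y : Subset n

  -- The end vertex need not lie in X, so that walks can reach its boundary.
  data Within (X : Subset n) : ℕ → Fin n → Fin n → Set where
    here : Within X m x x
    step : x ∈ X → Adj x y → Within X m y z → Within X (suc m) x z

  Within-⊆ : X ⊆ Y → Within X m x y → Within Y m x y
  Within-⊆ X⊆Y here = here
  Within-⊆ X⊆Y (step x∈X xy w) = step (X⊆Y x∈X) xy (Within-⊆ X⊆Y w)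

  Within-≤ : m ≤ m′ → Within X m x y → Within X m′ x y
  Within-≤ m≤m′ here = here
  Within-≤ (s≤s m≤m′) (step x∈X xy w) = step x∈X xy (Within-≤ m≤m′ w)

  Within-trans : Within X m x y → Within X m′ y z → Within X (m + m′) x z
  Within-trans {m = m} {m′ = m′} here w = Within-≤ (m≤n+m m′ m) w
  Within-trans (step x∈X xy v) w = step x∈X xy (Within-trans v w)

  Within-snoc : Within X m x y → y ∈ X → Adj y z → Within X (suc m) x z
  Within-snoc here y∈X yz = step y∈X yz here
  Within-snoc (step x∈X xy w) y∈X yz = step x∈X xy (Within-snoc w y∈X yz)

  start∈ : Within X m x y → y ∈ X → x ∈ X
  start∈ here y∈X = y∈X
  start∈ (step x∈X _ _) _ = x∈X

  Within-sym : Within X m x y → y ∈ X → Within X m y x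
  Within-sym here _ = here
  Within-sym (step x∈X xy w) y∈X = Within-snoc (Within-sym w y∈X) (start∈ w y∈X) (Adj-sym xy)

  prefix : ℕ → Within X m x y → Subset n
  prefix zero _ = ∅
  prefix (suc k) (here {x = x}) = ⁅ x ⁆
  prefix (suc k) (step {x = x} _ _ w) = ⁅ x ⁆ ∪ prefix k w

  ∣prefix∣≤ : ∀ k (w : Within X m x y) → ∣ prefix k w ∣ ≤ k
  ∣prefix∣≤ zero _ = ∣∅∣≤ n
  ∣prefix∣≤ (suc k) (here {x = x}) = ≤-trans (≤-reflexive (∣⁅x⁆∣≡1 x)) (s≤s z≤n)
  ∣prefix∣≤ (suc k) (step {x = x} _ _ w) =
    ≤-trans (∣p∪q∣≤∣p∣+∣q∣ ⁅ x ⁆ (prefix k w))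
            (+-mono-≤ (≤-reflexive (∣⁅x⁆∣≡1 x)) (∣prefix∣≤ k w))

  prefix-mono : (w : Within X m x y) → k ≤ k′ → prefix k w ⊆ prefix k′ w
  prefix-mono w z≤n = ∅-elim
  prefix-mono here (s≤s _) x∈ = x∈
  prefix-mono {k = suc k} {suc k′} (step {x = x} _ _ w) (s≤s k≤k′) =
    ∪-elim ⁅ x ⁆ (prefix k w) (p⊆p∪q (prefix k′ w))
                              (q⊆p∪q ⁅ x ⁆ (prefix k′ w) ∘ prefix-mono w k≤k′)

  vertices : Within X m x y → Subset n
  vertices {m = m} w = prefix (suc m) w

  end∈vertices : (w : Within X m x y) → y ∈ vertices w
  end∈vertices here = x∈⁅x⁆ _
  end∈vertices (step _ _ w) = q⊆p∪q _ (vertices w) (end∈vertices w)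

  vertices⊆ : (w : Within X m x y) → y ∈ X → vertices w ⊆ X
  vertices⊆ {X} here y∈X = ⁅⁆-elim (_∈ X) y∈X
  vertices⊆ {X} (step {x = x} x∈X _ w) y∈X =
    ∪-elim ⁅ x ⁆ (vertices w) (⁅⁆-elim (_∈ X) x∈X) (vertices⊆ w y∈X)

  record On {X m x y} (w : Within X m x y) (p : Fin n) : Set where
    field
      {before after} : ℕ
      before+after≡m : before + after ≡ m
      ∈prefix        : p ∈ prefix (suc before) w
      suffix         : Within X after p y

  vertices⇒On : (w : Within X m x y) → Lift (On w) (vertices w)
  vertices⇒On {x = x} here = ⁅⁆-elim (On here) (record
    { before = 0 ; before+after≡m = refl ; ∈prefix = x∈⁅x⁆ x ; suffix = here })
  vertices⇒On w@(step {x = x} x∈X xy v) = ∪-elim ⁅ x ⁆ (vertices v)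
    (⁅⁆-elim (On w) (record
      { before = 0 ; before+after≡m = refl ; ∈prefix = p⊆p∪q ∅ (x∈⁅x⁆ x) ; suffix = w }))
    λ p∈v → let open On (vertices⇒On v p∈v) in record
      { before = suc before
      ; before+after≡m = cong suc before+after≡m
      ; ∈prefix = q⊆p∪q ⁅ x ⁆ (prefix (suc before) v) ∈prefix
      ; suffix = suffix
      }

  Shortest : Within X m x y → Set
  Shortest {X} {m} {x} {y} _ = ∀ {k} → Within X k x y → m ≤ k

  Shortest⇒∈prefix : {w : Within X m x y} → Shortest w →
                     p ∈ vertices w → Within X k x p → p ∈ prefix (suc k) w
  Shortest⇒∈prefix {k = k} {w = w} shortest p∈w xp =
    let open On (vertices⇒On w p∈w)
        before≤k = +-cancelʳ-≤ after before k
          (subst (_≤ k + after) (sym before+after≡m) (shortest (Within-trans xp suffix)))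
    in prefix-mono w (s≤s before≤k) ∈prefix

module Connectivity (G : Graph) where
  open Graph G renaming (sym to Adj-sym)
  open Walks G

  private variable
    m : ℕ
    u v x y : Fin n
    A B X Y : Subset n

  Linked : Subset n → Fin n → Fin n → Set
  Linked X x y = ∃ λ m → Within X m x y

  Linked-⊆ : X ⊆ Y → Linked X x y → Linked Y x y
  Linked-⊆ X⊆Y (m , w) = m , Within-⊆ X⊆Y w

  Rooted : Subset n → Fin n → Set
  Rooted A x = x ∈ A × Lift (Linked A x) A

  Rooted-⁅⁆ : Rooted ⁅ x ⁆ x
  Rooted-⁅⁆ {x} = x∈⁅x⁆ x , ⁅⁆-elim (Linked ⁅ x ⁆ x) (0 , here)

  Rooted-∪ : Rooted A x → Rooted B x → Rooted (A ∪ B) x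
  Rooted-∪ {A} {B = B} (x∈A , linkedA) (_ , linkedB) =
    p⊆p∪q B x∈A , ∪-elim A B (Linked-⊆ (p⊆p∪q B) ∘ linkedA) (Linked-⊆ (q⊆p∪q A B) ∘ linkedB)

  Rooted-snoc : Rooted A x → u ∈ A → Adj u v → Rooted (A ∪ ⁅ v ⁆) x
  Rooted-snoc {A} {x} {v = v} (x∈A , linked) u∈A uv =
    p⊆p∪q ⁅ v ⁆ x∈A ,
    ∪-elim A ⁅ v ⁆ (Linked-⊆ (p⊆p∪q ⁅ v ⁆) ∘ linked) (⁅⁆-elim (Linked (A ∪ ⁅ v ⁆) x) linked-v)
    where
    linked-v : Linked (A ∪ ⁅ v ⁆) x v
    linked-v = let m , w = linked u∈A in suc m , Within-⊆ (p⊆p∪q ⁅ v ⁆) (Within-snoc w u∈A uv)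

  Rooted-cons : Adj x y → Rooted A y → Rooted (⁅ x ⁆ ∪ A) x
  Rooted-cons {x} {A = A} xy (_ , linked) =
    x∈⁅x⁆∪A , ∪-elim ⁅ x ⁆ A (⁅⁆-elim (Linked (⁅ x ⁆ ∪ A) x) (0 , here)) through-y
    where
    x∈⁅x⁆∪A : x ∈ ⁅ x ⁆ ∪ A
    x∈⁅x⁆∪A = p⊆p∪q A (x∈⁅x⁆ x)

    through-y : Lift (Linked (⁅ x ⁆ ∪ A) x) A
    through-y z∈A =
      let m , w = linked z∈A in suc m , step x∈⁅x⁆∪A xy (Within-⊆ (q⊆p∪q ⁅ x ⁆ A) w)

  vertices-rooted : (w : Within X m x y) → Rooted (vertices w) x
  vertices-rooted here = Rooted-⁅⁆
  vertices-rooted (step _ xy w) = Rooted-cons xy (vertices-rooted w)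

  Connected : Subset n → Set
  Connected A = ∃ (Rooted A)

  Connected⇒Linked : Connected A → u ∈ A → v ∈ A → Linked A u v
  Connected⇒Linked (_ , _ , linked) u∈A v∈A =
    let m , w = linked u∈A
        m′ , w′ = linked v∈A
    in m + m′ , Within-trans (Within-sym w u∈A) w′

  Disjoint : Subset n → Subset n → Set
  Disjoint A B = Lift (_∉ B) A

  Disjoint-⊆ : X ⊆ Y → Disjoint Y B → Disjoint X B
  Disjoint-⊆ X⊆Y disjoint x∈X = disjoint (X⊆Y x∈X)

  Touch : Subset n → Subset n → Set
  Touch A B = ∃₂ λ u v → u ∈ A × v ∈ B × Adj u v

  Touch-⊆ : X ⊆ Y → Touch X B → Touch Y B
  Touch-⊆ X⊆Y (u , v , u∈X , v∈B , uv) = u , v , X⊆Y u∈X , v∈B , uv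

  Joined : Subset n → Subset n → Set
  Joined A B = Disjoint A B × Touch A B

  Joined-sym : Symmetric Joined
  Joined-sym (disjoint , u , v , u∈A , v∈B , uv) =
    (λ x∈B x∈A → disjoint x∈A x∈B) , v , u , v∈B , u∈A , Adj-sym uv

  branchSets⇒CliqueMinor : ∀ {t} (B : Fin t → Subset n) → (∀ i → Connected (B i)) →
                           (∀ {i j} → i ≢ j → Joined (B i) (B j)) → CliqueMinor G t
  branchSets⇒CliqueMinor {t} B connected joined = record
    { branch = branch
    ; nonempty = λ i → let v , v∈ , _ = connected i in v , ∈⇒branch v∈
    ; connected = λ i u v u∈ v∈ →
        let _ , w = Connected⇒Linked (connected i) (branch⇒∈ u u∈) (branch⇒∈ v v∈)
        in Within⇒WalkIn w v∈
    ; adjacent = λ i j i≢j →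
        let _ , u , v , u∈ , v∈ , uv = joined i≢j
        in u , v , ∈⇒branch u∈ , ∈⇒branch v∈ , uv
    }
    where
    branch : Fin n → Maybe (Fin t)
    branch v with any? (λ i → v ∈? B i)
    ... | yes (i , _) = just i
    ... | no _ = nothing

    branch⇒∈ : ∀ v {i} → branch v ≡ just i → v ∈ B i
    branch⇒∈ v eq with any? (λ i → v ∈? B i)
    branch⇒∈ v refl | yes (_ , v∈) = v∈
    branch⇒∈ v () | no _

    ∈⇒branch : ∀ {i} → v ∈ B i → branch v ≡ just i
    ∈⇒branch {v} {i} v∈Bi with any? (λ i → v ∈? B i)
    ... | no ∄ = contradiction (i , v∈Bi) ∄
    ... | yes (j , v∈Bj) with j ≟ i
    ... | yes j≡i = cong just j≡i
    ... | no j≢i = contradiction v∈Bi (proj₁ (joined j≢i) v∈Bj)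

    Within⇒WalkIn : ∀ {i} → Within (B i) m u v → branch v ≡ just i →
                    WalkIn G (λ w → branch w ≡ just i) u v
    Within⇒WalkIn here v∈ = here v∈
    Within⇒WalkIn (step u∈ uw w) v∈ = step (∈⇒branch u∈) uw (Within⇒WalkIn w v∈)

  AllPairs-Joined⇒CliqueMinor : ∀ {t Bs} → AllPairs Joined Bs → All Connected Bs →
                                t ≤ length Bs → CliqueMinor G t
  AllPairs-Joined⇒CliqueMinor {Bs = Bs} joined connected t≤ = branchSets⇒CliqueMinor
    (λ i → lookup Bs (inject≤ i t≤))
    (λ i → All.lookup connected (∈-lookup (inject≤ i t≤)))
    (λ i≢j → AllPairs-lookup Joined-sym joined (i≢j ∘ inject≤-injective t≤ t≤ _ _))

module Thinness (G : Graph) where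
  open Graph G using (n)
  open Walks G

  private variable
    d ρ b b′ : ℕ
    x : Fin n
    L N N′ X Y : Subset n

  Covers : ℕ → Subset n → Fin n → Subset n → Subset n → Set
  Covers d X x N L = Lift (λ p → Within X d x p → p ∈ L) N

  Covers-⊆ : Y ⊆ X → Covers d X x N L → Covers d Y x N L
  Covers-⊆ Y⊆X covers p∈N w = covers p∈N (Within-⊆ Y⊆X w)

  Thin : ℕ → ℕ → Subset n → Subset n → Set
  Thin ρ b X N = ∀ {x} → x ∈ X → ∃ λ L → ∣ L ∣ ≤ b × Covers ρ X x N L

  Thin-⊆ : Y ⊆ X → Thin ρ b X N → Thin ρ b Y N
  Thin-⊆ Y⊆X thin y∈Y =
    let L , ∣L∣≤b , covers = thin (Y⊆X y∈Y) in L , ∣L∣≤b , Covers-⊆ Y⊆X covers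

  Thin-≤ : b ≤ b′ → Thin ρ b X N → Thin ρ b′ X N
  Thin-≤ b≤b′ thin x∈X =
    let L , ∣L∣≤b , covers = thin x∈X in L , ≤-trans ∣L∣≤b b≤b′ , covers

  Thin-∅ : Thin ρ 0 X ∅
  Thin-∅ _ = ∅ , ∣∅∣≤ n , ∅-elim

  Thin-⁅⁆ : Thin ρ 1 X ⁅ x ⁆
  Thin-⁅⁆ {x = x} _ = ⁅ x ⁆ , ≤-reflexive (∣⁅x⁆∣≡1 x) , λ p∈⁅x⁆ _ → p∈⁅x⁆

  Thin-∪ : Thin ρ b X N → Thin ρ b′ X N′ → Thin ρ (b + b′) X (N ∪ N′)
  Thin-∪ {N = N} {N′ = N′} thin thin′ x∈X =
    let L , ∣L∣≤b , covers = thin x∈X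
        L′ , ∣L′∣≤b′ , covers′ = thin′ x∈X
    in L ∪ L′ , ≤-trans (∣p∪q∣≤∣p∣+∣q∣ L L′) (+-mono-≤ ∣L∣≤b ∣L′∣≤b′) ,
       ∪-elim N N′ (λ p∈N → p⊆p∪q L′ ∘ covers p∈N) (λ p∈N′ → q⊆p∪q L L′ ∘ covers′ p∈N′)

  Thin-⋃ : ∀ {Ns} → All (Thin ρ b X) Ns → Thin ρ (length Ns * b) X (⋃ Ns)
  Thin-⋃ [] = Thin-∅
  Thin-⋃ (thin ∷ thins) = Thin-∪ thin (Thin-⋃ thins)

module Boundary (G : Graph) where
  open Graph G using (n; Adj)
  open Walks G
  open Connectivity G using (Touch)
  open Thinness G using (Covers)

  private variable
    d m r : ℕ
    x y : Fin n
    F N S S′ X : Subset n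

  Encloses : Subset n → Subset n → Set
  Encloses F X = ∀ {x p} → x ∈ X → Adj x p → p ∉ X → p ∈ F

  Encloses-exit : Encloses F X → x ∈ X → Within X m x y → y ∉ X → y ∈ F
  Encloses-exit enc x∈X here x∉X = contradiction x∈X x∉X
  Encloses-exit enc _ (step x∈X xy here) y∉X = enc x∈X xy y∉X
  Encloses-exit enc _ (step _ _ w@(step x∈X _ _)) y∉X = Encloses-exit enc x∈X w y∉X

  Encloses⇒Covers-∁ : Encloses F X → x ∈ X → Covers d X x F S → Covers d X x (∁ X) S
  Encloses⇒Covers-∁ enc x∈X covers p∈∁X w = covers (Encloses-exit enc x∈X w (x∈∁p⇒x∉p p∈∁X)) w

  Encloses-─ : Encloses F X → Encloses (N ∪ F) (X ─ N)
  Encloses-─ {F} {X} {N} enc {p = p} x∈X─N xp p∉X─N with p ∈? N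
  ... | yes p∈N = p⊆p∪q F p∈N
  ... | no p∉N =
    q⊆p∪q N F (enc (p─q⊆p X N x∈X─N) xp λ p∈X → p∉X─N (x∈p∧x∉q⇒x∈p─q p∈X p∉N))

  Encloses-⋃-filter : ∀ {Bs} (touch? : ∀ B → Dec (Touch X B)) →
                      Encloses (⋃ Bs) X → Encloses (⋃ (filter touch? Bs)) X
  Encloses-⋃-filter {Bs = Bs} touch? enc {x} {p} x∈X xp p∉X =
    let _ , B∈Bs , p∈B = find (∈⋃⁻ Bs (enc x∈X xp p∉X))
    in ∈⋃⁺ (lose (∈-filter⁺ touch? B∈Bs (x , p , x∈X , p∈B , xp)) p∈B)

  Reach-exit : x ∈ X → Reach G S m x y →
               Within X m x y ⊎ ∃₂ λ i p → i < m × Within X i x p × p ∉ X × p ∉ S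
  Reach-exit x∈X (here _) = inj₁ here
  Reach-exit {X = X} x∈X (step {y = y} _ xy walk) with y ∈? X
  ... | yes y∈X with Reach-exit y∈X walk
  ... | inj₁ w = inj₁ (step x∈X xy w)
  ... | inj₂ (i , p , i<m , w , p∉) = inj₂ (suc i , p , s≤s i<m , step x∈X xy w , p∉)
  Reach-exit x∈X (step _ xy (here _)) | no _ = inj₁ (step x∈X xy here)
  Reach-exit x∈X (step {y = y} _ xy (step y∉S _ _)) | no y∉X =
    inj₂ (1 , y , s≤s (s≤s z≤n) , step x∈X xy here , y∉X , y∉S)

  -- A vertex outside X first met at the very last step of the robber's move need
  -- not be occupied before the move: the robber then stops on a vertex of S′.
  Reach-confined : x ∈ X → Covers (pred r) X x (∁ X) S → Covers r X x (∁ X) S′ →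
                   Reach G (S ∩ S′) r x y → y ∈ S′ ⊎ y ∈ X × Within X r x y
  Reach-confined {X = X} {y = y} x∈X guards guards′ walk with Reach-exit x∈X walk
  ... | inj₂ (_ , p , i<r , w , p∉X , p∉S∩S′) = contradiction
    (x∈p∩q⁺ (guards p∈∁X (Within-≤ (<⇒≤pred i<r) w) , guards′ p∈∁X (Within-≤ (<⇒≤ i<r) w)))
    p∉S∩S′
    where
    p∈∁X : p ∈ ∁ X
    p∈∁X = x∉p⇒x∈∁p p∉X
  ... | inj₁ w with y ∈? X
  ... | yes y∈X = inj₂ (y∈X , w)
  ... | no y∉X = inj₁ (guards′ (x∉p⇒x∈∁p y∉X) w)

module Decomposition (G : Graph) (adj? : Decidable (Graph.Adj G)) where
  open Graph G using (n)
  open Walks G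
  open Connectivity G
  open Thinness G
  open Boundary G

  private variable
    m ρ b : ℕ
    x y : Fin n
    N X Y : Subset n
    bags : List (Subset n)

  within? : ∀ X m x y → Dec (Within X m x y)
  within? X zero x y = map′ (λ { refl → here }) (λ { here → refl }) (x ≟ y)
  within? X (suc m) x y = map′
    (λ { (inj₁ refl) → here ; (inj₂ (x∈X , _ , xz , w)) → step x∈X xz w })
    (λ { here → inj₁ refl ; (step x∈X xz w) → inj₂ (x∈X , _ , xz , w) })
    (x ≟ y ⊎-dec x ∈? X ×-dec any? λ z → adj? x z ×-dec within? X m z y)

  touch? : Decidable Touch
  touch? A B = map′ (λ { (u , u∈A , v , v∈B , uv) → u , v , u∈A , v∈B , uv })
                    (λ { (u , v , u∈A , v∈B , uv) → u , u∈A , v , v∈B , uv })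
    (any? λ u → u ∈? A ×-dec any? λ v → v ∈? B ×-dec adj? u v)

  geodesic : Within X m x y → ∃ λ k → ∃ λ (w : Within X k x y) → Shortest w
  geodesic {m = zero} w = zero , w , λ _ → z≤n
  geodesic {X} {suc m} {x} {y} w with within? X m x y
  ... | yes w′ = geodesic w′
  ... | no ∄ = suc m , w , λ w′ → ≰⇒> λ k≤m → ∄ (Within-≤ k≤m w′)

  -- Two vertices of a shortest walk that are both within ρ of z are at most
  -- 2ρ apart on it, so those within ρ of z lie in a window of 2ρ + 1 vertices.
  Shortest⇒Thin : (w : Within X m x y) → Shortest w → y ∈ X →
                  Thin ρ (suc (ρ + ρ)) X (vertices w)
  Shortest⇒Thin here _ _ = Thin-≤ (s≤s z≤n) Thin-⁅⁆
  Shortest⇒Thin {X} {ρ = ρ} w@(step {x = x} x∈X xy v) shortest y∈X {z} z∈X with within? X ρ z x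
  ... | yes zx = prefix (suc (ρ + ρ)) w , ∣prefix∣≤ _ w , λ p∈w zp →
    Shortest⇒∈prefix {w = w} shortest p∈w (Within-trans (Within-sym zx x∈X) zp)
  ... | no ¬zx =
    let L , ∣L∣≤ , covers = Shortest⇒Thin v (λ u → ≤-pred (shortest (step x∈X xy u))) y∈X z∈X
    in L , ∣L∣≤ , ∪-elim ⁅ x ⁆ (vertices v)
         (λ p∈⁅x⁆ zp → contradiction zp (⁅⁆-elim (λ p → ¬ Within X ρ z p) ¬zx p∈⁅x⁆)) covers

  record Spider (X : Subset n) (x : Fin n) (bags : List (Subset n)) (N : Subset n) : Set where
    field
      ⊆territory : N ⊆ X
      rooted     : Rooted N x
      touches    : All (Touch N) bags
      thin       : ∀ ρ → Thin ρ (suc (length bags * suc (ρ + ρ))) X N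

  spider : Connected X → x ∈ X → All (Touch X) bags → ∃ (Spider X x bags)
  spider {X} {x} connected x∈X [] = ⁅ x ⁆ , record
    { ⊆territory = ⁅⁆-elim (_∈ X) x∈X
    ; rooted = Rooted-⁅⁆
    ; touches = []
    ; thin = λ _ → Thin-⁅⁆
    }
  spider {bags = _ ∷ bags} connected x∈X ((u , v , u∈X , v∈B , uv) ∷ touchesX) =
    let N , legs = spider connected x∈X touchesX
        open Spider legs
        _ , w , shortest = geodesic (proj₂ (Connected⇒Linked connected x∈X u∈X))
        P = vertices w
    in P ∪ N , record
    { ⊆territory = ∪-elim P N (vertices⊆ w u∈X) ⊆territory
    ; rooted = Rooted-∪ (vertices-rooted w) rooted
    ; touches = (u , v , p⊆p∪q N (end∈vertices w) , v∈B , uv) ∷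
                All.map (Touch-⊆ (q⊆p∪q P N)) touches
    ; thin = λ ρ → Thin-≤ (≤-reflexive (+-suc (suc (ρ + ρ)) (length bags * suc (ρ + ρ))))
                          (Thin-∪ (Shortest⇒Thin w shortest u∈X) (thin ρ))
    }

  record IsComponent (Y X : Subset n) : Set where
    field
      ⊆whole    : X ⊆ Y
      connected : Connected X
      closed    : Encloses (∁ Y) X

  component : x ∈ Y → ∃ λ X → x ∈ X × IsComponent Y X
  component {x} {Y} x∈Y = grow (⊃-wellFounded _) Rooted-⁅⁆ (⁅⁆-elim (_∈ Y) x∈Y)
    where
    grow : ∀ {S} → Acc _⊃_ S → Rooted S x → S ⊆ Y → ∃ λ X → x ∈ X × IsComponent Y X
    grow {S} (acc rec) rooted S⊆Y with touch? S (Y ─ S)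
    ... | no ∄ = S , proj₁ rooted , record
      { ⊆whole = S⊆Y
      ; connected = x , rooted
      ; closed = λ u∈S uv v∉S → x∉p⇒x∈∁p λ v∈Y →
          ∄ (_ , _ , u∈S , x∈p∧x∉q⇒x∈p─q v∈Y v∉S , uv)
      }
    ... | yes (u , v , u∈S , v∈Y─S , uv) =
      grow (rec (p⊂p∪⁅x⁆ (x∈p─q⇒x∉q Y S v∈Y─S))) (Rooted-snoc rooted u∈S uv)
           (∪-elim S ⁅ v ⁆ S⊆Y (⁅⁆-elim (_∈ Y) (p─q⊆p Y S v∈Y─S)))

  record Enclosure (ρ b : ℕ) (bags : List (Subset n)) (Y : Subset n) : Set where
    field
      encloses  : Encloses (⋃ bags) Y
      disjoint  : All (Disjoint Y) bags
      joined    : AllPairs Joined bags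
      connected : All Connected bags
      thin      : All (Thin ρ b Y) bags

  Enclosure-⊤ : Enclosure ρ b [] ⊤
  Enclosure-⊤ = record
    { encloses = λ _ _ p∉⊤ → contradiction ∈⊤ p∉⊤
    ; disjoint = []
    ; joined = []
    ; connected = []
    ; thin = []
    }

  Enclosure-component : IsComponent Y X → Enclosure ρ b bags Y → Enclosure ρ b bags X
  Enclosure-component X-component enclosure = record
    { encloses = λ x∈X xp p∉X → encloses (⊆whole x∈X) xp (x∈∁p⇒x∉p (closed x∈X xp p∉X))
    ; disjoint = All.map (Disjoint-⊆ ⊆whole) disjoint
    ; joined = joined
    ; connected = connected
    ; thin = All.map (Thin-⊆ ⊆whole) thin
    }
    where
    open IsComponent X-component using (⊆whole; closed)
    open Enclosure enclosure

  Enclosure-filter : Enclosure ρ b bags X → Enclosure ρ b (filter (touch? X) bags) X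
  Enclosure-filter {bags = bags} {X} enclosure = record
    { encloses = Encloses-⋃-filter {Bs = bags} (touch? X) encloses
    ; disjoint = All-filter⁺ (touch? X) disjoint
    ; joined = AllPairs-filter⁺ (touch? X) joined
    ; connected = All-filter⁺ (touch? X) connected
    ; thin = All-filter⁺ (touch? X) thin
    }
    where open Enclosure enclosure

  Enclosure-spider : Enclosure ρ b bags X → Spider X x bags N → Thin ρ b X N →
                     Enclosure ρ b (N ∷ bags) (X ─ N)
  Enclosure-spider {X = X} {x} {N} enclosure legs thinN = record
    { encloses = Encloses-─ encloses
    ; disjoint = x∈p─q⇒x∉q X N ∷ All.map (Disjoint-⊆ (p─q⊆p X N)) disjoint
    ; joined = All.zip (All.map (Disjoint-⊆ ⊆territory) disjoint , touches) ∷ joined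
    ; connected = (x , rooted) ∷ connected
    ; thin = All.map (Thin-⊆ (p─q⊆p X N)) (thinN ∷ thin)
    }
    where
    open Enclosure enclosure
    open Spider legs using (⊆territory; rooted; touches)

  record Territory (ρ b : ℕ) (bags : List (Subset n)) (X : Subset n) : Set where
    field
      enclosure : Enclosure ρ b bags X
      connected : Connected X
      touches   : All (Touch X) bags

  Territory⇒CliqueMinor : ∀ {t} → Territory ρ b bags X → t ≤ suc (length bags) → CliqueMinor G t
  Territory⇒CliqueMinor territory = AllPairs-Joined⇒CliqueMinor
    (All.zip (disjoint , touches) ∷ joined) (connectedX ∷ connected)
    where
    open Territory territory using (enclosure; touches) renaming (connected to connectedX)
    open Enclosure enclosure

  Enclosure⇒Territory : IsComponent Y X → Enclosure ρ b bags Y →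
                        Territory ρ b (filter (touch? X) bags) X
  Enclosure⇒Territory {X = X} {bags = bags} X-component enclosure = record
    { enclosure = Enclosure-filter (Enclosure-component X-component enclosure)
    ; connected = IsComponent.connected X-component
    ; touches = all-filter (touch? X) bags
    }

-- The robber moves by up to r, and the cops must then hold every bag vertex
-- within r - 1 of its new position.
pursuitRadius : ℕ → ℕ
pursuitRadius r = r + pred r

bagCost : ℕ → ℕ → ℕ
bagCost r s = suc (s * suc (pursuitRadius r + pursuitRadius r))

module Strategy (G : Graph) (adj? : Decidable (Graph.Adj G)) (r s : ℕ)
                (noMinor : ¬ CliqueMinor G (2 + s)) where
  open Graph G using (n)
  open Walks G
  open Thinness G
  open Boundary G
  open Decomposition G adj?

  private variable
    x : Fin n
    S X Y : Subset n

  ρ b : ℕ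
  ρ = pursuitRadius r
  b = bagCost r s

  length-bags≤s : ∀ {bags} → Territory ρ b bags X → length bags ≤ s
  length-bags≤s territory = ≤-pred (≰⇒> (noMinor ∘ Territory⇒CliqueMinor territory ∘ s≤s))

  record Position (S : Subset n) (x : Fin n) (X : Subset n) : Set where
    field
      {bags}    : List (Subset n)
      territory : Territory ρ b bags X
      robber∈X  : x ∈ X
      guarded   : Covers (pred r) X x (∁ X) S

  confine : ∀ {bags} → Enclosure ρ b bags Y → x ∈ Y → Covers (pred r) Y x (⋃ bags) S →
            ∃ λ X → X ⊆ Y × Position S x X
  confine enclosure x∈Y covers =
    let X , x∈X , X-component = component x∈Y
        open IsComponent X-component using (⊆whole)
    in X , ⊆whole , record
    { territory = Enclosure⇒Territory X-component enclosure
    ; robber∈X = x∈X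
    ; guarded = Encloses⇒Covers-∁ (Enclosure.encloses (Enclosure-component X-component enclosure))
                                  x∈X (Covers-⊆ ⊆whole covers)
    }

  advance : ∀ {bags N x′} → Territory ρ b bags X → x ∈ X → Spider X x bags N → Thin ρ b X N →
            Covers ρ X x (⋃ (N ∷ bags)) S → x′ ∈ X → Within X r x x′ →
            x′ ∈ S ⊎ ∃ λ X′ → X′ ⊂ X × Position S x′ X′
  advance {X} {x} {bags = bags} {N} {x′} territory x∈X legs thinN covers x′∈X xx′ with x′ ∈? N
  ... | yes x′∈N = inj₁ (covers (p⊆p∪q (⋃ bags) x′∈N) (Within-≤ (m≤m+n r (pred r)) xx′))
  ... | no x′∉N =
    let X′ , X′⊆X─N , position = confine
          (Enclosure-spider (Territory.enclosure territory) legs thinN)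
          (x∈p∧x∉q⇒x∈p─q x′∈X x′∉N)
          (λ p∈⋃ w → covers p∈⋃ (Within-trans xx′ (Within-⊆ (p─q⊆p X N) w)))
        x∈N = proj₁ (Spider.rooted legs)
        X─N⊂X = p∩q≢∅⇒p─q⊂p X N (x , x∈p∩q⁺ (x∈X , x∈N))
    in inj₂ (X′ , ⊆-⊂-trans X′⊆X─N X─N⊂X , position)

  round : Position S x X → ∃ λ S′ → ∣ S′ ∣ ≤ suc s * b ×
          (∀ x′ → Reach G (S ∩ S′) r x x′ → x′ ∈ S′ ⊎ ∃ λ X′ → X′ ⊂ X × Position S′ x′ X′)
  round position =
    let open Position position
        open Territory territory
        open Enclosure enclosure using (encloses; thin)
        few = length-bags≤s territory
        N , legs = spider connected robber∈X touches
        thinN = Thin-≤ (s≤s (*-monoˡ-≤ (suc (ρ + ρ)) few)) (Spider.thin legs ρ)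
        S′ , ∣S′∣≤ , covers = Thin-⋃ (thinN ∷ thin) robber∈X
        guards = Encloses⇒Covers-∁ encloses robber∈X λ p∈⋃ w →
                   covers (q⊆p∪q N (⋃ bags) p∈⋃) (Within-≤ (m≤m+n r (pred r)) w)
    in S′ , ≤-trans ∣S′∣≤ (*-monoˡ-≤ b (s≤s few)) , λ x′ walk →
       [ inj₁ , uncurry (advance territory robber∈X legs thinN covers) ]′
         (Reach-confined robber∈X guarded guards walk)

  play : Acc _⊂_ X → Position S x X → CopsWinFrom G r (suc s * b) S x
  play (acc rec) position =
    let S′ , ∣S′∣≤ , respond = round position
    in win S′ ∣S′∣≤ λ x′ walk →
       map₂ (λ (X′ , X′⊂X , position′) → play (rec X′⊂X) position′) (respond x′ walk)

  copsWin : CopsWin G r (suc s * b)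
  copsWin = ∅ , ∣∅∣≤ n , λ x →
    let X , _ , position = confine Enclosure-⊤ (∈⊤ {x = x}) ∅-elim
    in inj₂ (play (⊂-wellFounded X) position)

record SpanningSubgraph (G : Graph) : Set₁ where
  open Graph G using (n; Adj; irref)
  field
    _~_   : Fin n → Fin n → Set
    ~-sym : Symmetric _~_
    ~⇒Adj : ∀ {u v} → u ~ v → Adj u v

  graph : Graph
  graph = record { n = n ; Adj = _~_ ; sym = ~-sym ; irref = irref ∘ ~⇒Adj }

module _ {G : Graph} (H : SpanningSubgraph G) where
  open Graph G using (Adj)
  open SpanningSubgraph H

  WalkIn-mono : ∀ {P u v} → WalkIn graph P u v → WalkIn G P u v
  WalkIn-mono (here p) = here p
  WalkIn-mono (step p uv w) = step p (~⇒Adj uv) (WalkIn-mono w)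

  CliqueMinor-mono : ∀ {t} → CliqueMinor graph t → CliqueMinor G t
  CliqueMinor-mono minor = record
    { branch = branch
    ; nonempty = nonempty
    ; connected = λ i u v u∈ v∈ → WalkIn-mono (connected i u v u∈ v∈)
    ; adjacent = λ i j i≢j → let u , v , u∈ , v∈ , uv = adjacent i j i≢j in
                             u , v , u∈ , v∈ , ~⇒Adj uv
    }
    where open CliqueMinor minor

  NewEdge : Set
  NewEdge = ∃₂ λ u v → Adj u v × ¬ u ~ v

  Reach⇒Reach⊎NewEdge : Decidable _~_ → ∀ {S m x y} → Reach G S m x y →
                        Reach graph S m x y ⊎ NewEdge
  Reach⇒Reach⊎NewEdge _~?_ (here x∉S) = inj₁ (here x∉S)
  Reach⇒Reach⊎NewEdge _~?_ (step {x = x} {y = y} x∉S xy walk) with x ~? y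
  ... | no x≁y = inj₂ (x , y , xy , x≁y)
  ... | yes x~y = map₁ (step x∉S x~y) (Reach⇒Reach⊎NewEdge _~?_ walk)

  CopsWinFrom-lift : Decidable _~_ → ∀ {r k} → (NewEdge → ∀ S x → CopsWinFrom G r k S x) →
                     ∀ {S x} → CopsWinFrom graph r k S x → CopsWinFrom G r k S x
  CopsWinFrom-lift _~?_ restart (win S′ ∣S′∣≤k respond) = win S′ ∣S′∣≤k reply
    where
    reply : ∀ x′ → Reach G _ _ _ x′ → x′ ∈ S′ ⊎ CopsWinFrom G _ _ S′ x′
    reply x′ walk with Reach⇒Reach⊎NewEdge _~?_ walk
    ... | inj₂ newEdge = inj₂ (restart newEdge S′ x′)
    ... | inj₁ walkH with respond x′ walkH
    ... | inj₁ caught = inj₁ caught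
    ... | inj₂ wins = inj₂ (CopsWinFrom-lift _~?_ restart wins)

module Exploration (G : Graph) where
  open Graph G renaming (sym to Adj-sym)

  IsEdge : Fin (n * n) → Set
  IsEdge = uncurry Adj ∘ remQuot n

  seen : (E : Subset (n * n)) → Lift IsEdge E → SpanningSubgraph G
  seen E E⊆edges = record
    { _~_ = λ u v → combine u v ∈ E ⊎ combine v u ∈ E
    ; ~-sym = swap
    ; ~⇒Adj = [ ∈E⇒Adj , Adj-sym ∘ ∈E⇒Adj ]′
    }
    where
    ∈E⇒Adj : ∀ {u v} → combine u v ∈ E → Adj u v
    ∈E⇒Adj {u} {v} uv∈E = subst (uncurry Adj) (remQuot-combine u v) (E⊆edges uv∈E)

  module _ {r k : ℕ} (wins : (H : SpanningSubgraph G) → Decidable (SpanningSubgraph._~_ H) →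
                             CopsWin (SpanningSubgraph.graph H) r k) where

    CopsWinFrom-seen : ∀ {E} → Acc _⊃_ E → Lift IsEdge E → ∀ S x → CopsWinFrom G r k S x
    CopsWinFrom-seen {E} (acc rec) E⊆edges S x =
      let C₀ , ∣C₀∣≤k , wins₀ = wins H _~?_
      in win C₀ ∣C₀∣≤k λ x′ _ → map₂ (CopsWinFrom-lift H _~?_ restart) (wins₀ x′)
      where
      H : SpanningSubgraph G
      H = seen E E⊆edges

      _~?_ : Decidable (SpanningSubgraph._~_ H)
      u ~? v = combine u v ∈? E ⊎-dec combine v u ∈? E

      restart : NewEdge H → ∀ S x → CopsWinFrom G r k S x
      restart (u , v , uv , u≁v) = CopsWinFrom-seen (rec (p⊂p∪⁅x⁆ (u≁v ∘ inj₁)))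
        (∪-elim E ⁅ combine u v ⁆ E⊆edges
          (⁅⁆-elim IsEdge (subst (uncurry Adj) (sym (remQuot-combine u v)) uv)))

    decidable⇒CopsWin : CopsWin G r k
    decidable⇒CopsWin = ∅ , ∣∅∣≤ n , λ x →
      inj₂ (CopsWinFrom-seen (⊃-wellFounded ∅) ∅-elim ∅ x)

copsWin : ∀ G r s → ¬ CliqueMinor G (2 + s) → CopsWin G r (suc s * bagCost r s)
copsWin G r s noMinor = Exploration.decidable⇒CopsWin G λ H _~?_ →
  Strategy.copsWin (SpanningSubgraph.graph H) _~?_ r s (noMinor ∘ CliqueMinor-mono H)

2*[1+n]C2≡[1+n]*n : ∀ n → 2 * (suc n C 2) ≡ suc n * n
2*[1+n]C2≡[1+n]*n zero = refl
2*[1+n]C2≡[1+n]*n (suc n) = begin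
  2 * (suc (suc n) C 2)              ≡⟨ cong (2 *_) (nCk+nC[k+1]≡[n+1]C[k+1] (suc n) 1) ⟨
  2 * (suc n C 1 + suc n C 2)        ≡⟨ *-distribˡ-+ 2 (suc n C 1) (suc n C 2) ⟩
  2 * (suc n C 1) + 2 * (suc n C 2)  ≡⟨ cong (λ m → 2 * m + 2 * (suc n C 2)) (nC1≡n (suc n)) ⟩
  2 * suc n + 2 * (suc n C 2)        ≡⟨ cong (2 * suc n +_) (2*[1+n]C2≡[1+n]*n n) ⟩
  2 * suc n + suc n * n              ≡⟨ expand n ⟩
  suc (suc n) * suc n                ∎
  where
  open ≡-Reasoning
  expand : ∀ n → 2 * suc n + suc n * n ≡ suc (suc n) * suc n
  expand = solve-∀

[1+s]*bagCost≤[1+s]C2*[8r+1] : ∀ r s .{{_ : NonZero r}} .{{_ : NonZero s}} →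
                               suc s * bagCost r s ≤ (suc s C 2) * (8 * r + 1)
[1+s]*bagCost≤[1+s]C2*[8r+1] (suc r) (suc s) = *-cancelˡ-≤ 2 (begin
  2 * (suc (suc s) * bagCost (suc r) (suc s))
    ≤⟨ m≤m+n _ (suc (suc s) * (3 * s + 1)) ⟩
  2 * (suc (suc s) * bagCost (suc r) (suc s)) + suc (suc s) * (3 * s + 1)
    ≡⟨ expand r s ⟩
  suc (suc s) * suc s * (8 * suc r + 1)
    ≡⟨ cong (_* (8 * suc r + 1)) (2*[1+n]C2≡[1+n]*n (suc s)) ⟨
  2 * (suc (suc s) C 2) * (8 * suc r + 1)
    ≡⟨ *-assoc 2 (suc (suc s) C 2) (8 * suc r + 1) ⟩
  2 * ((suc (suc s) C 2) * (8 * suc r + 1)) ∎)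
  where
  open ≤-Reasoning
  expand : ∀ r s → 2 * (suc (suc s) * suc (suc s * suc (suc r + r + (suc r + r)))) +
                   suc (suc s) * (3 * s + 1) ≡ suc (suc s) * suc s * (8 * suc r + 1)
  expand = solve-∀

theorem5 : (r t : ℕ) → 1 ≤ r → 3 ≤ t → (G : Graph) → ¬ HasCliqueMinor G t →
           CopWidthAtMost G r (((t ∸ 1) C 2) * (8 * r + 1))
theorem5 r@(suc _) (suc (suc s@(suc _))) _ (s≤s (s≤s (s≤s _))) G noMinor =
  suc s * bagCost r s , s≤s z≤n , [1+s]*bagCost≤[1+s]C2*[8r+1] r s , copsWin G r s noMinor
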